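{- Define $!_{a}:\mathbb{N}\to\mathbb{Z}^+$ by $0!_{a}=1$, $1!_{a}=1$ and, inductively, by setting $(n+1)!_{a}=n!_{a}$ whenever $n=3m-1$ for some integer $m\ge1$, and $$n!_{a}=\begin{cases} n!\,(n+1)!\,\prod_{j=1}^{n-1}\big((n-j)!_{a}\big)^2, & \text{if } n=3m-1 \text{ for some integer } m\ge1,\\[4pt] n!\,\prod_{j=1}^{n-1}\big((n-j)!_{a}\big)^2, & \text{if } n=3m+1 \text{ for some integer } m\ge1,\end{cases}$$ where $n!$ and $(n+1)!$ without subscript denote ordinary factorials. Then $!_{a}$ is an exceptional abstract factorial.
   Context: $\mathbb{N}=\{0,1,2,\dots\}$ and $\mathbb{Z}^+=\{1,2,3,\dots\}$. An abstract factorial is a function $!_{a}:\mathbb{N}\to\mathbb{Z}^+$, $n\mapsto n!_{a}$, such that: (1) $0!_{a}=1$; (2) for all integers $0\le k\le n$, the generalized binomial coefficient $\binom{n}{k}_{a}:=\frac{n!_{a}}{k!_{a}\,(n-k)!_{a}}$ is a positive integer; (3) for every positive integer $n$, the ordinary factorial $n!$ divides $n!_{a}$. An abstract factorial is called exceptional if $\limsup_{k\to\infty}\frac{1}{r_k}=1$, where $r_k=\frac{(k+1)!_{a}}{k!_{a}}$. -}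

module Defs where

open import Data.Integer.Base using (+_)
open import Data.Nat.Base
  using (ℕ; zero; suc; NonZero; _+_; _*_; _∸_; _^_; _!; _≤_)
open import Data.Nat.Divisibility using (_∣_)
open import Data.Nat.DivMod using (_%_; [m+kn]%n≡m%n)
open import Data.Nat.Properties
  using (*-comm; *-assoc; m*n≢0)
open import Data.Nat.Solver using (module +-*-Solver)
open import Data.Product.Base using (_×_; ∃-syntax; Σ-syntax)
open import Data.Rational.Base as ℚ using (ℚ; 0ℚ; 1ℚ; _/_; 1/_; Positive)
open import Data.Rational.Properties using (normalize-pos; pos⇒nonZero)
open import Relation.Binary.PropositionalEquality
  using (_≡_; refl; sym; trans; cong; cong₂; subst; module ≡-Reasoning)

-- Limit superior, for rational sequences with a rational value L:
-- for every ε > 0, eventually x k < L + ε, and infinitely often L - ε < x k.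
-- (Suprema of tails need not exist in ℚ, so inf-sup is not available.)
IsLimSup : (ℕ → ℚ) → ℚ → Set
IsLimSup x L = ∀ (ε : ℚ) → 0ℚ ℚ.< ε →
    (∃[ N ] ∀ k → N ≤ k → x k ℚ.< L ℚ.+ ε)
  × (∀ N → ∃[ k ] N ≤ k × L ℚ.- ε ℚ.< x k)

IsPositiveInteger : ℚ → Set
IsPositiveInteger q = ∃[ c ] NonZero c × q ≡ + c / 1

-- A function ℕ → ℤ⁺ is a function a : ℕ → ℕ with a proof that it is nowhere 0.
module _ (a : ℕ → ℕ) (a≢0 : ∀ n → NonZero (a n)) where

  -- Only meaningful for k ≤ n, because of the truncated subtraction.
  binomial : ℕ → ℕ → ℚ
  binomial n k = (+ a n / (a k * a (n ∸ k))) {{m*n≢0 _ _ {{a≢0 k}} {{a≢0 (n ∸ k)}}}}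

  ratio : ℕ → ℚ
  ratio k = (+ a (suc k) / a k) {{a≢0 k}}

  ratio-positive : ∀ k → Positive (ratio k)
  ratio-positive k = normalize-pos (a (suc k)) (a k) {{a≢0 k}} {{a≢0 (suc k)}}

  ratio⁻¹ : ℕ → ℚ
  ratio⁻¹ k = (1/ ratio k) {{pos⇒nonZero (ratio k) {{ratio-positive k}}}}

record IsAbstractFactorial (a : ℕ → ℕ) : Set where
  field
    positive          : ∀ n → NonZero (a n)
    at-0              : a 0 ≡ 1
    binomial-integral : ∀ k n → k ≤ n → IsPositiveInteger (binomial a positive n k)
    !-divides         : ∀ n → 1 ≤ n → n ! ∣ a n

IsExceptional : (a : ℕ → ℕ) → IsAbstractFactorial a → Set
IsExceptional a isAF = IsLimSup (ratio⁻¹ a positive) 1ℚ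
  where open IsAbstractFactorial isAF

IsExceptionalAbstractFactorial : (ℕ → ℕ) → Set
IsExceptionalAbstractFactorial a = Σ[ isAF ∈ IsAbstractFactorial a ] IsExceptional a isAF

-- ∏[1≤j≤ n ] f = f 1 * f 2 * ⋯ * f n
∏[1≤j≤_] : ℕ → (ℕ → ℕ) → ℕ
∏[1≤j≤ zero  ] f = 1
∏[1≤j≤ suc n ] f = ∏[1≤j≤ n ] f * f (suc n)

record Recurrence (a : ℕ → ℕ) : Set where
  field
    at-0    : a 0 ≡ 1
    at-1    : a 1 ≡ 1
    at-3m   : ∀ m → 1 ≤ m → let n = 3 * m ∸ 1 in a (n + 1) ≡ a n
    at-3m-1 : ∀ m → 1 ≤ m → let n = 3 * m ∸ 1 in
              a n ≡ n ! * (n + 1) ! * ∏[1≤j≤ n ∸ 1 ] (λ j → a (n ∸ j) ^ 2)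
    at-3m+1 : ∀ m → 1 ≤ m → let n = 3 * m + 1 in
              a n ≡ n ! * ∏[1≤j≤ n ∸ 1 ] (λ j → a (n ∸ j) ^ 2)

-- The value at n from n % 3, the previous value and the product of the earlier squares.
step : (residue n previous squares : ℕ) → ℕ
step 0 n p s = p
step 1 n p s = n ! * s
step _ n p s = n ! * (n + 1) ! * s

-- The function defined by the recurrence (see !ₐ-recurrence below).  To recurse
-- structurally, ∏_{j=1}^{n-1} ((n-j) !ₐ)² is taken in the opposite order, as
-- squares (n-1), where squares n = ∏_{i=1}^{n} (i !ₐ)².
infix 9 _!ₐ

_!ₐ     : ℕ → ℕ
squares : ℕ → ℕ

0               !ₐ = 1
1               !ₐ = 1
suc (suc n)     !ₐ = step (suc (suc n) % 3) (suc (suc n)) (suc n !ₐ) (squares (suc n))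

squares zero    = 1
squares (suc n) = squares n * suc n !ₐ ^ 2

private
  ∏-front : ∀ n f → ∏[1≤j≤ suc n ] f ≡ f 1 * ∏[1≤j≤ n ] (λ j → f (suc j))
  ∏-front zero    f = *-comm 1 (f 1)
  ∏-front (suc n) f = trans (cong (_* f (suc (suc n))) (∏-front n f))
                            (*-assoc (f 1) _ _)

  squares≡∏ : ∀ n → squares n ≡ ∏[1≤j≤ n ] (λ j → (suc n ∸ j) !ₐ ^ 2)
  squares≡∏ zero    = refl
  squares≡∏ (suc n) = begin
    squares n * suc n !ₐ ^ 2
      ≡⟨ *-comm (squares n) _ ⟩
    suc n !ₐ ^ 2 * squares n
      ≡⟨ cong (suc n !ₐ ^ 2 *_) (squares≡∏ n) ⟩
    suc n !ₐ ^ 2 * ∏[1≤j≤ n ] (λ j → (suc n ∸ j) !ₐ ^ 2)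
      ≡⟨ ∏-front n (λ j → (suc (suc n) ∸ j) !ₐ ^ 2) ⟨
    ∏[1≤j≤ suc n ] (λ j → (suc (suc n) ∸ j) !ₐ ^ 2) ∎
    where open ≡-Reasoning

  !ₐ-step : ∀ n r → suc (suc n) % 3 ≡ r →
            suc (suc n) !ₐ ≡ step r (suc (suc n)) (suc n !ₐ)
              (∏[1≤j≤ suc n ] (λ j → (suc (suc n) ∸ j) !ₐ ^ 2))
  !ₐ-step n r eq = cong₂ (λ r s → step r (suc (suc n)) (suc n !ₐ) s) eq (squares≡∏ (suc n))

  open +-*-Solver

  3m-1≡ : ∀ m → 3 * suc m ∸ 1 ≡ 2 + m * 3
  3m-1≡ = solve 1 (λ m → m :+ (con 1 :+ m :+ (con 1 :+ m :+ con 0)) := con 2 :+ m :* con 3) refl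

  3m+1≡ : ∀ m → 3 * suc m + 1 ≡ 4 + m * 3
  3m+1≡ = solve 1 (λ m → con 3 :* (con 1 :+ m) :+ con 1 := con 4 :+ m :* con 3) refl

  n+1≡ : ∀ n → n + 1 ≡ suc n
  n+1≡ = solve 1 (λ n → n :+ con 1 := con 1 :+ n) refl

!ₐ-recurrence : Recurrence _!ₐ
!ₐ-recurrence = record
  { at-0    = refl
  ; at-1    = refl
  ; at-3m   = λ where (suc m) _ → at-3m m
  ; at-3m-1 = λ where (suc m) _ → at-3m-1 m
  ; at-3m+1 = λ where (suc m) _ → at-3m+1 m
  }
  where
  at-3m : ∀ m → (3 * suc m ∸ 1 + 1) !ₐ ≡ (3 * suc m ∸ 1) !ₐ
  at-3m m rewrite 3m-1≡ m | n+1≡ (m * 3) =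
    !ₐ-step (1 + m * 3) 0 ([m+kn]%n≡m%n 3 m 3)

  at-3m-1 : ∀ m → let n = 3 * suc m ∸ 1 in
            n !ₐ ≡ n ! * (n + 1) ! * ∏[1≤j≤ n ∸ 1 ] (λ j → (n ∸ j) !ₐ ^ 2)
  at-3m-1 m rewrite 3m-1≡ m = !ₐ-step (m * 3) 2 ([m+kn]%n≡m%n 2 m 3)

  at-3m+1 : ∀ m → let n = 3 * suc m + 1 in
            n !ₐ ≡ n ! * ∏[1≤j≤ n ∸ 1 ] (λ j → (n ∸ j) !ₐ ^ 2)
  at-3m+1 m = subst (λ n → n !ₐ ≡ n ! * ∏[1≤j≤ n ∸ 1 ] (λ j → (n ∸ j) !ₐ ^ 2))
    (sym (3m+1≡ m)) (!ₐ-step (2 + m * 3) 1 ([m+kn]%n≡m%n 4 m 3))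

{-# OPTIONS --safe #-}

-- Except when 3 ∣ n, the value n !ₐ is a multiple of ∏_{i<n} (i !ₐ)²; because of
-- the squares, i !ₐ * j !ₐ divides this product for all 1 ≤ i, j < n, even if i = j.
-- When 3 ∣ n, the same works with n - 1 in place of n, provided i, j < n - 1; the
-- remaining case is {i, j} = {1, n - 1}, where 1 !ₐ = 1 and n !ₐ = (n - 1) !ₐ.
-- Hence k !ₐ ∣ (k + 1) !ₐ, so that 1 / r_k ≤ 1, with equality when k ≡ 2 (mod 3).
module Submission where

open import Defs

open import Data.Fin.Base using (zero; suc)
open import Data.Integer.Base as ℤ using (+_)
import Data.Integer.Properties as ℤ
open import Data.Nat.Base
  using (ℕ; zero; suc; NonZero; _+_; _*_; _∸_; _^_; _!; _≤_; s≤s)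
open import Data.Nat.Divisibility
open import Data.Nat.DivMod using (_%_; _divMod_; result; [m+kn]%n≡m%n)
open import Data.Nat.Properties
open import Data.Product.Base using (_×_; _,_; ∃-syntax)
open import Data.Rational.Base as ℚ using (1ℚ; _/_; 1/_; Positive)
import Data.Rational.Properties as ℚ
open import Data.Rational.Unnormalised.Base using (mkℚᵘ; *≡*; *≤*)
import Data.Rational.Unnormalised.Properties as ℚᵘ
open import Data.Sum.Base using (_⊎_; inj₁; inj₂)
open import Relation.Binary.PropositionalEquality
  using (_≡_; refl; sym; trans; cong; subst)

-- Cross-multiplying unnormalised fractions avoids any gcd. `mkℚᵘ` stores the denominator minus one,
-- hence the arguments `n` and `0`.
m*n/n≡m/1 : ∀ m n .{{_ : NonZero n}} → + (m * n) / n ≡ + m / 1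
m*n/n≡m/1 m (suc n) = ℚ.fromℚᵘ-cong {mkℚᵘ (+ (m * suc n)) n} {mkℚᵘ (+ m) 0}
  (*≡* (trans (ℤ.*-identityʳ _) (ℤ.pos-* m (suc n))))

n/n≡1 : ∀ n .{{_ : NonZero n}} → + n / n ≡ 1ℚ
n/n≡1 n = trans (ℚ./-cong (cong +_ (sym (*-identityˡ n))) refl) (m*n/n≡m/1 1 n)

n≤m⇒1≤m/n : ∀ {m n} .{{_ : NonZero n}} → n ≤ m → 1ℚ ℚ.≤ + m / n
n≤m⇒1≤m/n {m} {suc n} n≤m = ℚ.toℚᵘ-cancel-≤
  (ℚᵘ.≤-respʳ-≃ (ℚᵘ.≃-sym (ℚ.toℚᵘ-fromℚᵘ (mkℚᵘ (+ m) n)))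
    (*≤* (subst (ℤ._≤ + m ℤ.* + 1) (ℤ.*-comm (+ suc n) (+ 1)) (ℤ.*-monoʳ-≤-nonNeg (+ 1) (ℤ.+≤+ n≤m)))))

1≤p⇒1/p≤1 : ∀ p .{{_ : Positive p}} → 1ℚ ℚ.≤ p → (1/ p) {{ℚ.pos⇒nonZero p}} ℚ.≤ 1ℚ
1≤p⇒1/p≤1 p 1≤p = begin
  1/ p          ≡⟨ ℚ.*-identityʳ (1/ p) ⟨
  1/ p ℚ.* 1ℚ   ≤⟨ ℚ.*-monoˡ-≤-nonNeg (1/ p) 1≤p ⟩
  1/ p ℚ.* p    ≡⟨ ℚ.*-inverseˡ p ⟩
  1ℚ            ∎
  where
  open ℚ.≤-Reasoning
  instance
    p≢0 = ℚ.pos⇒nonZero p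
    1/p≥0 = ℚ.pos⇒nonNeg (1/ p) {{ℚ.1/pos⇒pos p}}

-- With `p` a variable, matching on `refl` also replaces it in the type of the `NonZero` instance,
-- and `1/ 1ℚ` computes.
p≡1⇒1/p≡1 : ∀ {p} .{{_ : ℚ.NonZero p}} → p ≡ 1ℚ → 1/ p ≡ 1ℚ
p≡1⇒1/p≡1 refl = refl

step≢0 : ∀ r n p s → NonZero p → NonZero s → NonZero (step r n p s)
step≢0 0             n p s p≢0 s≢0 = p≢0
step≢0 1             n p s p≢0 s≢0 = m*n≢0 (n !) s {{n !≢0}} {{s≢0}}
step≢0 (suc (suc _)) n p s p≢0 s≢0 =
  m*n≢0 (n ! * (n + 1) !) s {{n !* (n + 1) !≢0}} {{s≢0}}

!ₐ≢0      : ∀ n → NonZero (n !ₐ)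
squares≢0 : ∀ n → NonZero (squares n)

!ₐ≢0 0             = _
!ₐ≢0 1             = _
!ₐ≢0 (suc (suc n)) =
  step≢0 (suc (suc n) % 3) (suc (suc n)) (suc n !ₐ) _ (!ₐ≢0 (suc n)) (squares≢0 (suc n))

squares≢0 zero    = _
squares≢0 (suc n) =
  m*n≢0 (squares n) _ {{squares≢0 n}} {{m^n≢0 (suc n !ₐ) 2 {{ !ₐ≢0 (suc n)}}}}

-- For symbolic `n` the remainder does not reduce, so an equation for it is what lets `step`
-- compute.
!ₐ-residue : ∀ n r → suc (suc n) % 3 ≡ r →
             suc (suc n) !ₐ ≡ step r (suc (suc n)) (suc n !ₐ) (squares (suc n))
!ₐ-residue n r = cong (λ r → step r (suc (suc n)) (suc n !ₐ) (squares (suc n)))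

[3q+2]!ₐ : ∀ q → let n = 2 + q * 3 in n !ₐ ≡ n ! * (n + 1) ! * squares (1 + q * 3)
[3q+2]!ₐ q = !ₐ-residue (q * 3) 2 ([m+kn]%n≡m%n 2 q 3)

[3q+3]!ₐ : ∀ q → (3 + q * 3) !ₐ ≡ (2 + q * 3) !ₐ
[3q+3]!ₐ q = !ₐ-residue (1 + q * 3) 0 ([m+kn]%n≡m%n 3 q 3)

[3q+4]!ₐ : ∀ q → let n = 4 + q * 3 in n !ₐ ≡ n ! * squares (3 + q * 3)
[3q+4]!ₐ q = !ₐ-residue (2 + q * 3) 1 ([m+kn]%n≡m%n 4 q 3)

-- All that divisibility uses of the recurrence. The second alternative is the case where 3 divides
-- `2 + n`; its product stops at `n`, one index earlier.
!ₐ-multiple : ∀ n →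
  ((2 + n) ! * squares (1 + n) ∣ (2 + n) !ₐ) ⊎
  ((2 + n) !ₐ ≡ (1 + n) !ₐ × (2 + n) ! * squares n ∣ (2 + n) !ₐ)
!ₐ-multiple n with n divMod 3
-- The remainder is that of `n`, so `2 + n` is successively 2, 0 and 1 modulo 3.
... | result q zero refl = inj₁ (∣-trans
  (*-monoˡ-∣ (squares (1 + n)) (m∣m*n {(2 + n) !} ((2 + n + 1) !)))
  (∣-reflexive (sym ([3q+2]!ₐ q))))
-- The value is copied from `1 + n`, whose second ordinary factorial is exactly `(2 + n) !`.
... | result q (suc zero) refl = inj₂ ([3q+3]!ₐ q , ∣-trans
  (*-monoˡ-∣ (squares n) (subst (λ k → (2 + n) ! ∣ (1 + n) ! * k !) (+-comm 1 (1 + n))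
    (n∣m*n ((1 + n) !) {(2 + n) !})))
  (∣-reflexive (sym (trans ([3q+3]!ₐ q) ([3q+2]!ₐ q)))))
... | result q (suc (suc zero)) refl = inj₁ (∣-reflexive (sym ([3q+4]!ₐ q)))

n!∣n!ₐ : ∀ n → n ! ∣ n !ₐ
n!∣n!ₐ 0             = ∣-refl
n!∣n!ₐ 1             = ∣-refl
n!∣n!ₐ (suc (suc n)) with !ₐ-multiple n
... | inj₁ d       = ∣-trans (m∣m*n (squares (1 + n))) d
... | inj₂ (_ , d) = ∣-trans (m∣m*n (squares n)) d

m∣m^2 : ∀ m → m ∣ m ^ 2
m∣m^2 m = m∣m*n (m ^ 1)

m*m∣m^2 : ∀ m → m * m ∣ m ^ 2
m*m∣m^2 m = ∣-reflexive (cong (m *_) (sym (*-identityʳ m)))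

!ₐ∣squares : ∀ {i n} → suc i ≤ n → suc i !ₐ ∣ squares n
!ₐ∣squares {i} {suc n} i<1+n with m≤n⇒m<n∨m≡n i<1+n
... | inj₁ (s≤s i<n) = ∣m⇒∣m*n _ (!ₐ∣squares i<n)
... | inj₂ refl      = ∣n⇒∣m*n (squares n) (m∣m^2 (suc n !ₐ))

-- Induction peels off the last square: it supplies one factor for each index equal to its own, and
-- `squares n` supplies the rest.
!ₐ*!ₐ∣squares : ∀ {i j n} → suc i ≤ n → suc j ≤ n → suc i !ₐ * suc j !ₐ ∣ squares n
!ₐ*!ₐ∣squares {i} {j} {suc n} i<1+n j<1+n with m≤n⇒m<n∨m≡n i<1+n | m≤n⇒m<n∨m≡n j<1+n
... | inj₁ (s≤s i<n) | inj₁ (s≤s j<n) = ∣m⇒∣m*n _ (!ₐ*!ₐ∣squares i<n j<n)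
... | inj₁ (s≤s i<n) | inj₂ refl = *-pres-∣ (!ₐ∣squares i<n) (m∣m^2 (suc n !ₐ))
... | inj₂ refl | inj₁ (s≤s j<n) = subst (_∣ squares (suc n)) (*-comm (suc j !ₐ) (suc n !ₐ))
  (*-pres-∣ (!ₐ∣squares j<n) (m∣m^2 (suc n !ₐ)))
... | inj₂ refl | inj₂ refl = ∣n⇒∣m*n (squares n) (m*m∣m^2 (suc n !ₐ))

!ₐ*!ₐ∣[2+n]!ₐ : ∀ i j n → i + j ≡ n → suc i !ₐ * suc j !ₐ ∣ (2 + n) !ₐ
!ₐ*!ₐ∣[2+n]!ₐ i j n refl with !ₐ-multiple n
... | inj₁ d = ∣-trans
  (∣n⇒∣m*n ((2 + n) !) (!ₐ*!ₐ∣squares (s≤s (m≤m+n i j)) (s≤s (m≤n+m j i)))) d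
!ₐ*!ₐ∣[2+n]!ₐ zero j n refl | inj₂ (eq , _) =
  ∣-reflexive (trans (*-identityˡ _) (sym eq))
!ₐ*!ₐ∣[2+n]!ₐ (suc i) zero n refl | inj₂ (eq , _) =
  ∣-reflexive (trans (*-identityʳ _)
    (trans (cong (λ k → suc k !ₐ) (sym (+-identityʳ (suc i)))) (sym eq)))
-- Both indices are at least 2 and sum to `2 + n`, so neither exceeds `n` and the shorter product
-- suffices.
!ₐ*!ₐ∣[2+n]!ₐ (suc i) (suc j) n refl | inj₂ (_ , d) = ∣-trans
  (∣n⇒∣m*n ((2 + n) !) (!ₐ*!ₐ∣squares
    (subst (2 + i ≤_) (sym (+-suc (suc i) j)) (s≤s (s≤s (m≤m+n i j))))
    (subst (2 + j ≤_) (+-suc i (suc j)) (m≤n+m (2 + j) i)))) d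

-- Integrality of the binomial coefficients, in additive form to avoid truncated subtraction.
!ₐ*!ₐ∣!ₐ : ∀ i j → i !ₐ * j !ₐ ∣ (i + j) !ₐ
!ₐ*!ₐ∣!ₐ zero    j       = ∣-reflexive (*-identityˡ (j !ₐ))
!ₐ*!ₐ∣!ₐ (suc i) zero    =
  ∣-reflexive (trans (*-identityʳ _) (cong _!ₐ (sym (+-identityʳ (suc i)))))
!ₐ*!ₐ∣!ₐ (suc i) (suc j) =
  subst (λ n → suc i !ₐ * suc j !ₐ ∣ suc n !ₐ) (sym (+-suc i j)) (!ₐ*!ₐ∣[2+n]!ₐ i j _ refl)

binomial-isPositiveInteger : ∀ k n → k ≤ n → IsPositiveInteger (binomial _!ₐ !ₐ≢0 n k)
binomial-isPositiveInteger k n k≤n =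
  -- The quotient is nonzero as a factor of the nonzero `n !ₐ`.
  quotient d , m*n≢0⇒m≢0 (quotient d) {{subst NonZero eq (!ₐ≢0 n)}} ,
  trans (ℚ./-cong (cong +_ eq) refl) (m*n/n≡m/1 (quotient d) (k !ₐ * (n ∸ k) !ₐ))
  where
  instance
    k!ₐ*[n∸k]!ₐ≢0 = m*n≢0 (k !ₐ) ((n ∸ k) !ₐ) {{ !ₐ≢0 k}} {{ !ₐ≢0 (n ∸ k)}}

  d : k !ₐ * (n ∸ k) !ₐ ∣ n !ₐ
  d = subst (λ m → k !ₐ * (n ∸ k) !ₐ ∣ m !ₐ) (m+[n∸m]≡n k≤n) (!ₐ*!ₐ∣!ₐ k (n ∸ k))

  eq : n !ₐ ≡ quotient d * (k !ₐ * (n ∸ k) !ₐ)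
  eq = m∣n⇒n≡quotient*m d

!ₐ-isAbstractFactorial : IsAbstractFactorial _!ₐ
!ₐ-isAbstractFactorial = record
  { positive          = !ₐ≢0
  ; at-0              = refl
  ; binomial-integral = binomial-isPositiveInteger
  ; !-divides         = λ n _ → n!∣n!ₐ n
  }

-- Integrality with one index equal to 1, as `1 !ₐ` is 1.
!ₐ-mono-suc : ∀ k → k !ₐ ≤ suc k !ₐ
!ₐ-mono-suc k = ∣⇒≤ {{ !ₐ≢0 (suc k)}}
  (subst (_∣ suc k !ₐ) (*-identityˡ (k !ₐ)) (!ₐ*!ₐ∣!ₐ 1 k))

ratio⁻¹≤1 : ∀ k → ratio⁻¹ _!ₐ !ₐ≢0 k ℚ.≤ 1ℚ
ratio⁻¹≤1 k = 1≤p⇒1/p≤1 (ratio _!ₐ !ₐ≢0 k) {{ratio-positive _!ₐ !ₐ≢0 k}}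
  (n≤m⇒1≤m/n {{ !ₐ≢0 k}} (!ₐ-mono-suc k))

ratio⁻¹[3q+2]≡1 : ∀ q → ratio⁻¹ _!ₐ !ₐ≢0 (2 + q * 3) ≡ 1ℚ
ratio⁻¹[3q+2]≡1 q = p≡1⇒1/p≡1
  {{ℚ.pos⇒nonZero (ratio _!ₐ !ₐ≢0 k) {{ratio-positive _!ₐ !ₐ≢0 k}}}}
  (trans (ℚ./-cong {{ !ₐ≢0 k}} {{ !ₐ≢0 k}} (cong +_ ([3q+3]!ₐ q)) refl) (n/n≡1 (k !ₐ) {{ !ₐ≢0 k}}))
  where k = 2 + q * 3

isLimSup : ∀ {x L} → (∀ k → x k ℚ.≤ L) → (∀ N → ∃[ k ] N ≤ k × x k ≡ L) → IsLimSup x L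
isLimSup {x} {L} x≤L x≡L ε 0<ε = (0 , λ k _ → ℚ.≤-<-trans (x≤L k) L<L+ε) , frequently
  where
  L<L+ε : L ℚ.< L ℚ.+ ε
  L<L+ε = subst (ℚ._< L ℚ.+ ε) (ℚ.+-identityʳ L) (ℚ.+-monoʳ-< L 0<ε)

  L-ε<L : L ℚ.- ε ℚ.< L
  -- Negating `0ℚ < ε` gives `- ε < - 0ℚ`, and `- 0ℚ` computes to `0ℚ`.
  L-ε<L = subst (L ℚ.- ε ℚ.<_) (ℚ.+-identityʳ L) (ℚ.+-monoʳ-< L (ℚ.neg-antimono-< 0<ε))

  frequently : ∀ N → ∃[ k ] N ≤ k × L ℚ.- ε ℚ.< x k
  frequently N with k , N≤k , xk≡L ← x≡L N = k , N≤k , subst (L ℚ.- ε ℚ.<_) (sym xk≡L) L-ε<L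

proposition12 : IsExceptionalAbstractFactorial _!ₐ
proposition12 = !ₐ-isAbstractFactorial , isLimSup ratio⁻¹≤1
  -- An index beyond `N` that is 2 modulo 3, where the next value repeats.
  λ N → 2 + N * 3 , ≤-trans (m≤m*n N 3) (m≤n+m (N * 3) 2) , ratio⁻¹[3q+2]≡1 N
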